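{- Let $f(n)$ be an arithmetic function for which a linear asymptotic with an estimate of the remainder term is known: $$\sum_{n\le x} f(n)=cx+O(g(x)),\qquad x\to\infty,$$ where $c\neq 0$. Then $$\sum_{n\le x} n f(n)=\frac{c x^2}{2}+O(x g(x))+O\left(\int_1^x g(t)\,dt\right)+O(1),\qquad x\to\infty.$$
   Context: An arithmetic function is a function defined on the positive integers with complex values. Sums $\sum_{n\le x}$ run over positive integers $n\le x$. Here $c$ is a constant and $g$ is the function appearing in the remainder term. $O(\cdot)$ is the usual Landau symbol as $x\to\infty$.
   Formalization: The function g in the remainder term is assumed to be nonnegative for all large x (the claim fails for some sign-changing g), and the integral of g from 1 to x is a Riemann integral, assumed to exist for every x ≥ 1. -}

module Defs where

open import Algebra.Core using (Op₁; Op₂)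
open import Algebra.Bundles using (CommutativeRing)
open import Algebra.Bundles.Raw using (RawMonoid)
open import Algebra.Structures using (IsCommutativeRing)
import Algebra.Definitions.RawMonoid as RawMonoidDefs
import Algebra.Properties.Ring as RingProps
open import Data.Bool.Base using (if_then_else_)
open import Data.Fin.Base using (toℕ)
open import Data.Nat.Base as ℕ using (ℕ; NonZero)
open import Data.Product.Base using (∃; _,_; proj₁; _×_)
open import Data.Sum.Base using (inj₁; inj₂)
open import Data.Unit.Polymorphic.Base using (⊤)
open import Level using (Level; suc)
open import Relation.Binary.Core using (Rel)
open import Relation.Binary.Structures using (IsDecTotalOrder)
open import Relation.Binary.PropositionalEquality
  using (_≡_; _≢_; sym; trans; cong; subst; subst₂)
open import Relation.Nullary.Decidable using (⌊_⌋)

record OrderedField (ℓ : Level) : Set (suc ℓ) where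
  infixl 6 _+_
  infixl 7 _*_
  infix  8 -_ _⁻¹
  infix  4 _≤_
  field
    ℝ                 : Set ℓ
    _+_ _*_           : Op₂ ℝ
    -_                : Op₁ ℝ
    0# 1#             : ℝ
    isCommutativeRing : IsCommutativeRing _≡_ _+_ _*_ -_ 0# 1#
    0≢1               : 0# ≢ 1#
    _⁻¹               : Op₁ ℝ    -- 0# ⁻¹ is unspecified
    ⁻¹-inverse        : ∀ x → x ≢ 0# → x * x ⁻¹ ≡ 1#
    _≤_               : Rel ℝ ℓ
    isDecTotalOrder   : IsDecTotalOrder _≡_ _≤_
    +-monoʳ-≤         : ∀ z {x y} → x ≤ y → z + x ≤ z + y
    *-nonneg          : ∀ {x y} → 0# ≤ x → 0# ≤ y → 0# ≤ x * y

  commutativeRing : CommutativeRing ℓ ℓ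
  commutativeRing = record { isCommutativeRing = isCommutativeRing }

  open CommutativeRing commutativeRing public
    using (ring; +-rawMonoid; _-_; +-assoc; +-comm; +-identityˡ; +-identityʳ;
           *-assoc; *-comm; *-identityˡ; *-identityʳ; zeroˡ; zeroʳ;
           distribˡ; distribʳ; -‿inverseˡ; -‿inverseʳ)
  open IsDecTotalOrder isDecTotalOrder public
    using (_≤?_; total; antisym)
    renaming (refl to ≤-refl; trans to ≤-trans)

  fromℕ : ℕ → ℝ
  fromℕ n = RawMonoidDefs._×_ +-rawMonoid n 1#

  UpperBound : (ℝ → Set ℓ) → ℝ → Set ℓ
  UpperBound P b = ∀ x → P x → x ≤ b

  IsLub : (ℝ → Set ℓ) → ℝ → Set ℓ
  IsLub P s = UpperBound P s × (∀ b → UpperBound P b → s ≤ b)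

-- The real numbers, characterised (classically, up to isomorphism) as a
-- Dedekind-complete ordered field.  Classically the order of any ordered field
-- is decidable and `archimedean` follows from `lub`.  Without excluded middle
-- neither is automatic: `lub` yields no actual natural number.
record RealField (ℓ : Level) : Set (suc ℓ) where
  field
    orderedField : OrderedField ℓ
  open OrderedField orderedField public
  field
    archimedean : ∀ x → ∃ λ n → x ≤ fromℕ n
    lub         : (P : ℝ → Set ℓ) → ∃ P → ∃ (UpperBound P) → ∃ (IsLub P)

module Analysis {ℓ : Level} (R : RealField ℓ) where
  open RealField R public
  open RingProps ring using (-‿distribˡ-*; -‿distribʳ-*; -‿involutive)

  infixl 7 _/_
  infix  4 _<_

  _<_ : Rel ℝ ℓ
  x < y = x ≤ y × x ≢ y

  _/_ : Op₂ ℝ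
  x / y = x * y ⁻¹

  ∣_∣ : ℝ → ℝ
  ∣ x ∣ = if ⌊ 0# ≤? x ⌋ then x else - x

  -- Order facts used to see that the supremum defining √ exists.

  +-nonneg : ∀ {x y} → 0# ≤ x → 0# ≤ y → 0# ≤ x + y
  +-nonneg {x} {y} 0≤x 0≤y =
    ≤-trans 0≤x (subst (_≤ x + y) (+-identityʳ x) (+-monoʳ-≤ x 0≤y))

  square-nonneg : ∀ x → 0# ≤ x * x
  square-nonneg x with total 0# x
  ... | inj₁ 0≤x = *-nonneg 0≤x 0≤x
  ... | inj₂ x≤0 = subst (0# ≤_) -x*-x≡x*x (*-nonneg 0≤-x 0≤-x)
    where
    0≤-x : 0# ≤ - x
    0≤-x = subst₂ _≤_ (-‿inverseˡ x) (+-identityʳ (- x)) (+-monoʳ-≤ (- x) x≤0)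
    -x*-x≡x*x : - x * - x ≡ x * x
    -x*-x≡x*x = trans (sym (-‿distribˡ-* x (- x)))
      (trans (cong -_ (sym (-‿distribʳ-* x x))) (-‿involutive (x * x)))

  0≤1 : 0# ≤ 1#
  0≤1 = subst (0# ≤_) (*-identityˡ 1#) (square-nonneg 1#)

  x≤x*x : ∀ {x} → 1# ≤ x → x ≤ x * x
  x≤x*x {x} 1≤x = subst₂ _≤_ (+-identityʳ x) x+x[x-1]≡x*x
      (+-monoʳ-≤ x (*-nonneg (≤-trans 0≤1 1≤x) 0≤x-1))
    where
    0≤x-1 : 0# ≤ - 1# + x
    0≤x-1 = subst (_≤ - 1# + x) (-‿inverseˡ 1#) (+-monoʳ-≤ (- 1#) 1≤x)
    x+x[x-1]≡x*x : x + x * (- 1# + x) ≡ x * x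
    x+x[x-1]≡x*x =
      trans (cong (_+ x * (- 1# + x)) (sym (*-identityʳ x)))
      (trans (sym (distribˡ x 1# (- 1# + x)))
      (cong (x *_)
        (trans (sym (+-assoc 1# (- 1#) x))
        (trans (cong (_+ x) (-‿inverseʳ 1#)) (+-identityˡ x)))))

  √-lub : ∀ a → 0# ≤ a → ∃ (IsLub (λ t → t * t ≤ a))
  √-lub a 0≤a = lub _ (0# , subst (_≤ a) (sym (zeroˡ 0#)) 0≤a) (1# + a , bound)
    where
    bound : ∀ t → t * t ≤ a → t ≤ 1# + a
    bound t t²≤a with total t 1#
    ... | inj₁ t≤1 =
      ≤-trans t≤1 (subst (_≤ 1# + a) (+-identityʳ 1#) (+-monoʳ-≤ 1# 0≤a))
    ... | inj₂ 1≤t = ≤-trans (x≤x*x 1≤t) (≤-trans t²≤a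
      (subst₂ _≤_ (+-identityʳ a) (+-comm a 1#) (+-monoʳ-≤ a 0≤1)))

  √ : ∀ a → 0# ≤ a → ℝ
  √ a 0≤a = proj₁ (√-lub a 0≤a)

  infixl 6 _+ℂ_ _-ℂ_
  infixl 7 _*ℂ_

  record ℂ : Set ℓ where
    constructor _+i_
    field
      re im : ℝ
  open ℂ public

  ofℝ : ℝ → ℂ
  ofℝ x = x +i 0#

  0ℂ : ℂ
  0ℂ = ofℝ 0#

  _+ℂ_ _-ℂ_ _*ℂ_ : Op₂ ℂ
  z +ℂ w = (re z + re w) +i (im z + im w)
  z -ℂ w = (re z - re w) +i (im z - im w)
  z *ℂ w = (re z * re w - im z * im w) +i (re z * im w + im z * re w)

  ‖_‖ : ℂ → ℝ
  ‖ z ‖ = √ (re z * re z + im z * im z)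
            (+-nonneg (square-nonneg (re z)) (square-nonneg (im z)))

  ℂ-+-rawMonoid : RawMonoid ℓ ℓ
  ℂ-+-rawMonoid = record { Carrier = ℂ ; _≈_ = _≡_ ; _∙_ = _+ℂ_ ; ε = 0ℂ }

  ArithmeticFunction : Set ℓ
  ArithmeticFunction = (n : ℕ) → .{{NonZero n}} → ℂ

  -- ∑≤ x f is the sum of f n over the positive integers n ≤ x: `archimedean`
  -- supplies an N with x ≤ N, so every such n occurs among 1, …, N.
  ∑≤ : ℝ → ArithmeticFunction → ℂ
  ∑≤ x f = sum {N} λ k →
      let n = ℕ.suc (toℕ k) in if ⌊ fromℕ n ≤? x ⌋ then f n else 0ℂ
    where
    open RawMonoidDefs ℂ-+-rawMonoid using (sum)
    N : ℕ
    N = proj₁ (archimedean x)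

  -- Landau's symbol for x → ∞.
  infix 4 _∈O_
  _∈O_ : (ℝ → ℂ) → (ℝ → ℝ) → Set ℓ
  E ∈O h = ∃ λ A → ∃ λ x₀ → ∀ x → x₀ ≤ x → ‖ E x ‖ ≤ A * ∣ h x ∣

  EventuallyNonneg : (ℝ → ℝ) → Set ℓ
  EventuallyNonneg g = ∃ λ x₀ → ∀ x → x₀ ≤ x → 0# ≤ g x

  -- A tagged partition of [a , b]: `cell t m` splits off the first subinterval
  -- [a , m], with tag t.
  data TaggedPartition (b : ℝ) : ℝ → Set ℓ where
    done : TaggedPartition b b
    cell : ∀ {a} (t m : ℝ) → a ≤ t → t ≤ m →
           TaggedPartition b m → TaggedPartition b a

  MeshAtMost : ∀ {a b} → ℝ → TaggedPartition b a → Set ℓ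
  MeshAtMost         δ done             = ⊤
  MeshAtMost {a = a} δ (cell t m _ _ P) = m - a ≤ δ × MeshAtMost δ P

  riemannSum : ∀ {a b} → (ℝ → ℝ) → TaggedPartition b a → ℝ
  riemannSum         g done             = 0#
  riemannSum {a = a} g (cell t m _ _ P) = g t * (m - a) + riemannSum g P

  -- For a ≤ b: g is Riemann integrable on [a , b] with integral I.
  IsRiemannIntegral : (ℝ → ℝ) → ℝ → ℝ → ℝ → Set ℓ
  IsRiemannIntegral g a b I =
    ∀ ε → 0# < ε → ∃ λ δ → 0# < δ ×
      (∀ (P : TaggedPartition b a) → MeshAtMost δ P → ∣ riemannSum g P - I ∣ ≤ ε)

{-# OPTIONS --safe #-}

-- With S(x) = ∑ f(n) = c x + E(x) and T(x) = ∑ n f(n), partial summation reads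
-- T(x) = x S(x) - ∫₀ˣ S = c x² / 2 + x E(x) - ∫₀ˣ E, so one takes E₁(x) = x E(x) and has
-- to bound Φ(x) = 2 ∫₀ˣ E by O(G(x)) + O(1).  Neither S nor E is ever integrated: between
-- consecutive integers Φ has an explicit increment, which compares with a term of a
-- left-tagged Riemann sum of g, and a fine enough partition of [1 , x] replaces that sum
-- by G(x) at bounded cost.  This is done for real and imaginary parts separately.  As G may
-- vanish at large x, where an O(G) term must vanish too, the term -Φ(x) / 2 goes into E₂ when
-- |G(x)| ≥ 1 and into E₃ otherwise.

module Submission where

open import Defs
open import Algebra.Bundles using (CommutativeRing)
import Algebra.Definitions.RawMonoid as RawMonoidDefs
import Algebra.Properties.AbelianGroup
import Algebra.Properties.Ring
import Algebra.Properties.Semiring.Mult.TCOptimised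
import Algebra.Solver.Ring
open import Algebra.Solver.Ring.AlmostCommutativeRing
  using (fromCommutativeRing; Induced-equivalence; _-Raw-AlmostCommutative⟶_)
open import Data.Bool.Base using (if_then_else_)
open import Data.Fin.Base using (Fin; zero; suc; toℕ)
open import Data.Integer.Base as ℤ using (ℤ; +_; -[1+_]; _⊖_; _◃_)
import Data.Integer.Properties as ℤ
import Data.Maybe.Base as Maybe
open import Data.Nat.Base as ℕ using (ℕ; zero; suc)
import Data.Nat.Properties as ℕ
open import Data.Product.Base using (∃; _×_; _,_; proj₁; proj₂)
import Data.Sign.Base as Sign
open import Data.Sum.Base using (_⊎_; inj₁; inj₂)
open import Data.Unit.Polymorphic.Base using (⊤; tt)
open import Relation.Binary.Bundles using (Poset)
open import Relation.Binary.Definitions using (WeaklyDecidable)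
open import Relation.Binary.PropositionalEquality
  using (_≡_; _≢_; refl; sym; trans; cong; cong₂; subst; subst₂; module ≡-Reasoning)
import Relation.Binary.Reasoning.PartialOrder as PartialOrderReasoning
import Relation.Binary.Reasoning.Setoid as SetoidReasoning
open import Relation.Binary.Structures using (IsDecTotalOrder)
open import Relation.Nullary.Decidable using (yes; no; ⌊_⌋; dec⇒maybe)
open import Relation.Nullary.Negation using (¬_; contradiction)

-- A ring solver with integer coefficients over any commutative ring.

module IntegerCoefficients {a ℓ} (R : CommutativeRing a ℓ) where
  open CommutativeRing R hiding (refl; sym; trans)
  open CommutativeRing R using () renaming (refl to ≈-refl; sym to ≈-sym; trans to ≈-trans)
  open Algebra.Properties.Ring ring
  open Algebra.Properties.AbelianGroup +-abelianGroup using (⁻¹-∙-comm)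
  open Algebra.Properties.Semiring.Mult.TCOptimised semiring renaming (_×_ to _·_)
  open SetoidReasoning setoid

  -- With this optimised multiple, `fromℤ (+ 1)` and `fromℤ (+ 2)` reduce to `1#` and `1# + 1#`, so
  -- solver constants match the terms of the proof by `refl`.
  fromℤ : ℤ → Carrier
  fromℤ (+ n)    = n · 1#
  fromℤ -[1+ n ] = - (suc n · 1#)

  fromℤ-⊖ : ∀ m n → fromℤ (m ⊖ n) ≈ m · 1# - n · 1#
  fromℤ-⊖ m zero = begin
    m · 1#        ≈⟨ +-identityʳ _ ⟨
    m · 1# + 0#   ≈⟨ +-congˡ -0#≈0# ⟨
    m · 1# - 0#   ∎
  fromℤ-⊖ zero (suc n) = ≈-sym (+-identityˡ _)
  -- The sum `1# - 1#` is inserted and its two halves are absorbed by the two multiples.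
  fromℤ-⊖ (suc m) (suc n) = begin
    fromℤ (suc m ⊖ suc n)                 ≡⟨ cong fromℤ (ℤ.[1+m]⊖[1+n]≡m⊖n m n) ⟩
    fromℤ (m ⊖ n)                         ≈⟨ fromℤ-⊖ m n ⟩
    m · 1# - n · 1#                       ≈⟨ +-congʳ (+-identityˡ _) ⟨
    0# + m · 1# - n · 1#                  ≈⟨ +-congʳ (+-congʳ (-‿inverseʳ 1#)) ⟨
    1# - 1# + m · 1# - n · 1#             ≈⟨ +-congʳ (≈-trans (+-assoc _ _ _)
                                                (≈-trans (+-congˡ (+-comm _ _)) (≈-sym (+-assoc _ _ _)))) ⟩
    1# + m · 1# - 1# - n · 1#             ≈⟨ +-assoc _ _ _ ⟩
    1# + m · 1# + (- 1# - n · 1#)         ≈⟨ +-congˡ (⁻¹-∙-comm _ _) ⟩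
    1# + m · 1# - (1# + n · 1#)           ≈⟨ +-cong (1+× m 1#) (-‿cong (1+× n 1#)) ⟨
    suc m · 1# - suc n · 1#               ∎

  -- Products of mixed sign are computed as `Sign.- ◃ n`, which reduces only once n is known to be
  -- zero or a successor.
  fromℤ-◃- : ∀ n → fromℤ (Sign.- ◃ n) ≈ - (n · 1#)
  fromℤ-◃- zero    = ≈-sym -0#≈0#
  fromℤ-◃- (suc n) = ≈-refl

  fromℤ-+ : ∀ i j → fromℤ (i ℤ.+ j) ≈ fromℤ i + fromℤ j
  fromℤ-+ (+ m)    (+ n)    = ×-homo-+ 1# m n
  fromℤ-+ (+ m)    -[1+ n ] = fromℤ-⊖ m (suc n)
  fromℤ-+ -[1+ m ] (+ n)    = ≈-trans (fromℤ-⊖ n (suc m)) (+-comm _ _)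
  fromℤ-+ -[1+ m ] -[1+ n ] = begin
    - (suc (suc (m ℕ.+ n)) · 1#)      ≡⟨ cong (λ k → - (suc k · 1#)) (ℕ.+-suc m n) ⟨
    - ((suc m ℕ.+ suc n) · 1#)        ≈⟨ -‿cong (×-homo-+ 1# (suc m) (suc n)) ⟩
    - (suc m · 1# + suc n · 1#)       ≈⟨ ⁻¹-∙-comm _ _ ⟨
    - (suc m · 1#) - suc n · 1#       ∎

  fromℤ-* : ∀ i j → fromℤ (i ℤ.* j) ≈ fromℤ i * fromℤ j
  fromℤ-* (+ m) (+ n) = begin
    fromℤ (Sign.+ ◃ m ℕ.* n) ≡⟨ cong fromℤ (ℤ.+◃n≡+n (m ℕ.* n)) ⟩
    (m ℕ.* n) · 1#           ≈⟨ ×1-homo-* m n ⟩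
    m · 1# * n · 1#          ∎
  fromℤ-* (+ m) -[1+ n ] = begin
    fromℤ (Sign.- ◃ m ℕ.* suc n)  ≈⟨ fromℤ-◃- (m ℕ.* suc n) ⟩
    - ((m ℕ.* suc n) · 1#)        ≈⟨ -‿cong (×1-homo-* m (suc n)) ⟩
    - (m · 1# * suc n · 1#)       ≈⟨ -‿distribʳ-* _ _ ⟩
    m · 1# * - (suc n · 1#)       ∎
  fromℤ-* -[1+ m ] (+ n) = begin
    fromℤ (Sign.- ◃ suc m ℕ.* n)  ≈⟨ fromℤ-◃- (suc m ℕ.* n) ⟩
    - ((suc m ℕ.* n) · 1#)        ≈⟨ -‿cong (×1-homo-* (suc m) n) ⟩
    - (suc m · 1# * n · 1#)       ≈⟨ -‿distribˡ-* _ _ ⟩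
    - (suc m · 1#) * n · 1#       ∎
  fromℤ-* -[1+ m ] -[1+ n ] = begin
    (suc m ℕ.* suc n) · 1#            ≈⟨ ×1-homo-* (suc m) (suc n) ⟩
    suc m · 1# * suc n · 1#           ≈⟨ -‿involutive _ ⟨
    - - (suc m · 1# * suc n · 1#)     ≈⟨ -‿cong (-‿distribʳ-* _ _) ⟩
    - (suc m · 1# * - (suc n · 1#))   ≈⟨ -‿distribˡ-* _ _ ⟩
    - (suc m · 1#) * - (suc n · 1#)   ∎

  fromℤ-neg : ∀ i → fromℤ (ℤ.- i) ≈ - fromℤ i
  fromℤ-neg (+ zero)  = ≈-sym -0#≈0#
  fromℤ-neg (+ suc n) = ≈-refl
  fromℤ-neg -[1+ n ]  = ≈-sym (-‿involutive _)

  morphism : ℤ.+-*-rawRing -Raw-AlmostCommutative⟶ fromCommutativeRing R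
  morphism = record
    { ⟦_⟧    = fromℤ
    ; +-homo = fromℤ-+
    ; *-homo = fromℤ-*
    ; -‿homo = fromℤ-neg
    ; 0-homo = ≈-refl
    ; 1-homo = ≈-refl
    }

  -- The solver asks for a sufficient test for two coefficients to agree in the ring; equality of
  -- integers is one.
  fromℤ-≟ : WeaklyDecidable (Induced-equivalence morphism)
  fromℤ-≟ i j = Maybe.map (λ i≡j → reflexive (cong fromℤ i≡j)) (dec⇒maybe (i ℤ.≟ j))

  open Algebra.Solver.Ring ℤ.+-*-rawRing (fromCommutativeRing R) morphism
    fromℤ-≟ public

-- Ordered-field arithmetic and the absolute value.

module OrderedFieldProperties {ℓ} (R : RealField ℓ) where
  open Analysis R
  open IsDecTotalOrder isDecTotalOrder using (isPartialOrder; _≟_)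
  open IntegerCoefficients commutativeRing
    using (solve; con; _:=_; _:+_; _:*_; _:-_; :-_)
  open Algebra.Properties.Ring ring using (-‿involutive)

  ≤-poset : Poset ℓ ℓ ℓ
  ≤-poset = record { isPartialOrder = isPartialOrder }

  open PartialOrderReasoning ≤-poset

  0≤y-x : ∀ {x y} → x ≤ y → 0# ≤ y - x
  0≤y-x {x} {y} x≤y = begin
    0#      ≡⟨ -‿inverseˡ x ⟨
    - x + x ≤⟨ +-monoʳ-≤ (- x) x≤y ⟩
    - x + y ≡⟨ +-comm (- x) y ⟩
    y - x   ∎

  -- Splits an inequality into the sign of a gap and a ring identity that the solver can check; many
  -- inequalities below are proved this way.
  gap⇒≤ : ∀ {x y} d → 0# ≤ d → y ≡ x + d → x ≤ y
  gap⇒≤ {x} {y} d 0≤d y≡x+d = begin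
    x      ≡⟨ +-identityʳ x ⟨
    x + 0# ≤⟨ +-monoʳ-≤ x 0≤d ⟩
    x + d  ≡⟨ y≡x+d ⟨
    y      ∎

  x≤x+y : ∀ x {y} → 0# ≤ y → x ≤ x + y
  x≤x+y x {y} 0≤y = gap⇒≤ y 0≤y refl

  +-mono-≤ : ∀ {x y u v} → x ≤ y → u ≤ v → x + u ≤ y + v
  +-mono-≤ {x} {y} {u} {v} x≤y u≤v =
    gap⇒≤ ((y - x) + (v - u)) (+-nonneg (0≤y-x x≤y) (0≤y-x u≤v))
      (solve 4 (λ x y u v → y :+ v := (x :+ u) :+ ((y :- x) :+ (v :- u))) refl x y u v)

  *-monoʳ-≤ : ∀ {x y z} → 0# ≤ z → x ≤ y → z * x ≤ z * y
  *-monoʳ-≤ {x} {y} {z} 0≤z x≤y =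
    gap⇒≤ (z * (y - x)) (*-nonneg 0≤z (0≤y-x x≤y))
      (solve 3 (λ x y z → z :* y := z :* x :+ z :* (y :- x)) refl x y z)

  *-monoˡ-≤ : ∀ {x y z} → 0# ≤ z → x ≤ y → x * z ≤ y * z
  *-monoˡ-≤ {x} {y} {z} 0≤z x≤y =
    subst₂ _≤_ (*-comm z x) (*-comm z y) (*-monoʳ-≤ 0≤z x≤y)

  neg-antimono-≤ : ∀ {x y} → x ≤ y → - y ≤ - x
  neg-antimono-≤ {x} {y} x≤y = gap⇒≤ (y - x) (0≤y-x x≤y)
    (solve 2 (λ x y → :- x := :- y :+ (y :- x)) refl x y)

  ≰⇒≥ : ∀ {x y} → ¬ (x ≤ y) → y ≤ x
  ≰⇒≥ {x} {y} x≰y with total x y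
  ... | inj₁ x≤y = contradiction x≤y x≰y
  ... | inj₂ y≤x = y≤x

  x*x≡0⇒x≡0 : ∀ x → x * x ≡ 0# → x ≡ 0#
  x*x≡0⇒x≡0 x x*x≡0 with x ≟ 0#
  ... | yes x≡0 = x≡0
  ... | no  x≢0 = begin-equality
    x                ≡⟨ *-identityʳ x ⟨
    x * 1#           ≡⟨ cong (x *_) (⁻¹-inverse x x≢0) ⟨
    x * (x * x ⁻¹)   ≡⟨ *-assoc x x (x ⁻¹) ⟨
    x * x * x ⁻¹     ≡⟨ cong (_* x ⁻¹) x*x≡0 ⟩
    0# * x ⁻¹        ≡⟨ zeroˡ (x ⁻¹) ⟩
    0#               ∎

  -- In the case y ≤ x, (x - y)² = (x² - y²) - 2 y (x - y) ≤ 0, so the square vanishes and x = y.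
  x*x≤y*y⇒x≤y : ∀ {x y} → 0# ≤ y → x * x ≤ y * y → x ≤ y
  x*x≤y*y⇒x≤y {x} {y} 0≤y x²≤y² with total x y
  ... | inj₁ x≤y = x≤y
  ... | inj₂ y≤x = subst (_≤ y) (sym x≡y) ≤-refl
    where
    [x-y]²≤0 : (x - y) * (x - y) ≤ 0#
    [x-y]²≤0 = gap⇒≤ ((y * y - x * x) + (1# + 1#) * (y * (x - y)))
      (+-nonneg (0≤y-x x²≤y²)
        (*-nonneg (+-nonneg 0≤1 0≤1) (*-nonneg 0≤y (0≤y-x y≤x))))
      (solve 2 (λ x y → con (+ 0) := (x :- y) :* (x :- y)
          :+ ((y :* y :- x :* x) :+ con (+ 2) :* (y :* (x :- y))))
        refl x y)
    x≡y : x ≡ y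
    x≡y = begin-equality
      x           ≡⟨ solve 2 (λ x y → x := y :+ (x :- y)) refl x y ⟩
      y + (x - y) ≡⟨ cong (_+_ y)
                       (x*x≡0⇒x≡0 (x - y) (antisym [x-y]²≤0 (square-nonneg (x - y)))) ⟩
      y + 0#      ≡⟨ +-identityʳ y ⟩
      y           ∎

  1≰0 : ¬ (1# ≤ 0#)
  1≰0 1≤0 = 0≢1 (antisym 0≤1 1≤0)

  1≤x⇒0≤x : ∀ {x} → 1# ≤ x → 0# ≤ x
  1≤x⇒0≤x = ≤-trans 0≤1

  1≤x⇒x≢0 : ∀ {x} → 1# ≤ x → x ≢ 0#
  1≤x⇒x≢0 1≤x x≡0 = 1≰0 (subst (1# ≤_) x≡0 1≤x)

  1≤1+1 : 1# ≤ 1# + 1#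
  1≤1+1 = x≤x+y 1# 0≤1

  -- x ⁻¹ is the product of the square (x ⁻¹)² and x.
  ⁻¹-nonneg : ∀ {x} → 0# ≤ x → x ≢ 0# → 0# ≤ x ⁻¹
  ⁻¹-nonneg {x} 0≤x x≢0 = subst (0# ≤_) x⁻¹²x≡x⁻¹
    (*-nonneg (square-nonneg (x ⁻¹)) 0≤x)
    where
    x⁻¹²x≡x⁻¹ : x ⁻¹ * x ⁻¹ * x ≡ x ⁻¹
    x⁻¹²x≡x⁻¹ = begin-equality
      x ⁻¹ * x ⁻¹ * x   ≡⟨ solve 2 (λ x y → y :* y :* x := y :* (x :* y)) refl x (x ⁻¹) ⟩
      x ⁻¹ * (x * x ⁻¹) ≡⟨ cong (x ⁻¹ *_) (⁻¹-inverse x x≢0) ⟩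
      x ⁻¹ * 1#         ≡⟨ *-identityʳ (x ⁻¹) ⟩
      x ⁻¹              ∎

  ⁻¹-pos : ∀ {x} → 0# ≤ x → x ≢ 0# → 0# < x ⁻¹
  ⁻¹-pos {x} 0≤x x≢0 = ⁻¹-nonneg 0≤x x≢0 , λ 0≡x⁻¹ → 0≢1 (begin-equality
    0#       ≡⟨ zeroʳ x ⟨
    x * 0#   ≡⟨ cong (x *_) 0≡x⁻¹ ⟩
    x * x ⁻¹ ≡⟨ ⁻¹-inverse x x≢0 ⟩
    1#       ∎)

  0<1 : 0# < 1#
  0<1 = 0≤1 , 0≢1

  positive-lower-bound : ∀ {x y} → 0# < x → 0# < y → ∃ λ z → 0# < z × z ≤ x × z ≤ y
  positive-lower-bound {x} {y} 0<x 0<y with total x y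
  ... | inj₁ x≤y = x , 0<x , ≤-refl , x≤y
  ... | inj₂ y≤x = y , 0<y , y≤x , ≤-refl

  fromℕ-nonneg : ∀ n → 0# ≤ fromℕ n
  fromℕ-nonneg zero    = ≤-refl
  fromℕ-nonneg (suc n) = +-nonneg 0≤1 (fromℕ-nonneg n)

  fromℕ-mono-≤ : ∀ {m n} → m ℕ.≤ n → fromℕ m ≤ fromℕ n
  fromℕ-mono-≤ {n = n} ℕ.z≤n = fromℕ-nonneg n
  fromℕ-mono-≤ (ℕ.s≤s m≤n)   = +-monoʳ-≤ 1# (fromℕ-mono-≤ m≤n)

  suc-fromℕ≰ : ∀ n → ¬ (fromℕ (suc n) ≤ fromℕ n)
  suc-fromℕ≰ n 1+n≤n = 1≰0 (gap⇒≤ (fromℕ n - (1# + fromℕ n)) (0≤y-x 1+n≤n)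
    (solve 1 (λ x → con (+ 0) := con (+ 1) :+ (x :- (con (+ 1) :+ x))) refl (fromℕ n)))

  -- Turns the branch on `0# ≤? x` into a disjunction with equations, so that later proofs need not
  -- unfold `∣_∣`.
  ∣∣-cases : ∀ x → (0# ≤ x × ∣ x ∣ ≡ x) ⊎ (0# ≤ - x × ∣ x ∣ ≡ - x)
  ∣∣-cases x with 0# ≤? x
  ... | yes 0≤x = inj₁ (0≤x , refl)
  ... | no  0≰x = inj₂ (subst (_≤ - x) -0≡0 (neg-antimono-≤ (≰⇒≥ 0≰x)) , refl)
    where
    -0≡0 : - 0# ≡ 0#
    -0≡0 = solve 0 (:- con (+ 0) := con (+ 0)) refl

  0≤∣x∣ : ∀ x → 0# ≤ ∣ x ∣
  0≤∣x∣ x with ∣∣-cases x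
  ... | inj₁ (0≤x  , ∣x∣≡x)  = subst (0# ≤_) (sym ∣x∣≡x) 0≤x
  ... | inj₂ (0≤-x , ∣x∣≡-x) = subst (0# ≤_) (sym ∣x∣≡-x) 0≤-x

  x≤∣x∣ : ∀ x → x ≤ ∣ x ∣
  x≤∣x∣ x with ∣∣-cases x
  ... | inj₁ (_    , ∣x∣≡x)  = subst (x ≤_) (sym ∣x∣≡x) ≤-refl
  ... | inj₂ (0≤-x , ∣x∣≡-x) = gap⇒≤ (- x + - x) (+-nonneg 0≤-x 0≤-x)
    (trans ∣x∣≡-x (solve 1 (λ x → :- x := x :+ (:- x :+ :- x)) refl x))

  -x≤∣x∣ : ∀ x → - x ≤ ∣ x ∣
  -x≤∣x∣ x with ∣∣-cases x
  ... | inj₁ (0≤x , ∣x∣≡x)  = gap⇒≤ (x + x) (+-nonneg 0≤x 0≤x)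
    (trans ∣x∣≡x (solve 1 (λ x → x := :- x :+ (x :+ x)) refl x))
  ... | inj₂ (_ , ∣x∣≡-x) = subst (- x ≤_) (sym ∣x∣≡-x) ≤-refl

  ∣x∣≤ : ∀ {x y} → x ≤ y → - x ≤ y → ∣ x ∣ ≤ y
  ∣x∣≤ {x} {y} x≤y -x≤y with ∣∣-cases x
  ... | inj₁ (_ , ∣x∣≡x)  = subst (_≤ y) (sym ∣x∣≡x) x≤y
  ... | inj₂ (_ , ∣x∣≡-x) = subst (_≤ y) (sym ∣x∣≡-x) -x≤y

  0≤x⇒∣x∣≡x : ∀ {x} → 0# ≤ x → ∣ x ∣ ≡ x
  0≤x⇒∣x∣≡x {x} 0≤x = antisym (∣x∣≤ ≤-refl (≤-trans -x≤0 0≤x)) (x≤∣x∣ x)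
    where
    -x≤0 : - x ≤ 0#
    -x≤0 = gap⇒≤ x 0≤x (sym (-‿inverseˡ x))

  ∣x∣*∣x∣≡x*x : ∀ x → ∣ x ∣ * ∣ x ∣ ≡ x * x
  ∣x∣*∣x∣≡x*x x with ∣∣-cases x
  ... | inj₁ (_ , ∣x∣≡x)  = cong₂ _*_ ∣x∣≡x ∣x∣≡x
  ... | inj₂ (_ , ∣x∣≡-x) = trans (cong₂ _*_ ∣x∣≡-x ∣x∣≡-x)
    (solve 1 (λ x → :- x :* :- x := x :* x) refl x)

  ∣x+y∣≤∣x∣+∣y∣ : ∀ x y → ∣ x + y ∣ ≤ ∣ x ∣ + ∣ y ∣
  ∣x+y∣≤∣x∣+∣y∣ x y = ∣x∣≤ (+-mono-≤ (x≤∣x∣ x) (x≤∣x∣ y)) (begin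
    - (x + y)     ≡⟨ solve 2 (λ x y → :- (x :+ y) := :- x :+ :- y) refl x y ⟩
    - x + - y     ≤⟨ +-mono-≤ (-x≤∣x∣ x) (-x≤∣x∣ y) ⟩
    ∣ x ∣ + ∣ y ∣ ∎)

  -- Both sides are nonnegative and have the same square, which replaces a case analysis on signs.
  ∣x*y∣≡∣x∣*∣y∣ : ∀ x y → ∣ x * y ∣ ≡ ∣ x ∣ * ∣ y ∣
  ∣x*y∣≡∣x∣*∣y∣ x y = antisym
    (x*x≤y*y⇒x≤y (*-nonneg (0≤∣x∣ x) (0≤∣x∣ y)) (subst (∣ x * y ∣ * ∣ x * y ∣ ≤_) squares ≤-refl))
    (x*x≤y*y⇒x≤y (0≤∣x∣ (x * y)) (subst (_≤ ∣ x * y ∣ * ∣ x * y ∣) squares ≤-refl))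
    where
    interchange : ∀ x y → x * y * (x * y) ≡ x * x * (y * y)
    interchange = solve 2 (λ x y → x :* y :* (x :* y) := x :* x :* (y :* y)) refl
    squares : ∣ x * y ∣ * ∣ x * y ∣ ≡ ∣ x ∣ * ∣ y ∣ * (∣ x ∣ * ∣ y ∣)
    squares = begin-equality
      ∣ x * y ∣ * ∣ x * y ∣             ≡⟨ ∣x∣*∣x∣≡x*x (x * y) ⟩
      x * y * (x * y)                   ≡⟨ interchange x y ⟩
      x * x * (y * y)                   ≡⟨ cong₂ _*_ (∣x∣*∣x∣≡x*x x) (∣x∣*∣x∣≡x*x y) ⟨
      ∣ x ∣ * ∣ x ∣ * (∣ y ∣ * ∣ y ∣)   ≡⟨ interchange ∣ x ∣ ∣ y ∣ ⟨
      ∣ x ∣ * ∣ y ∣ * (∣ x ∣ * ∣ y ∣)   ∎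

  ∣-x∣≡∣x∣ : ∀ x → ∣ - x ∣ ≡ ∣ x ∣
  ∣-x∣≡∣x∣ x = antisym
    (∣x∣≤ (-x≤∣x∣ x) (subst (_≤ ∣ x ∣) (sym (-‿involutive x)) (x≤∣x∣ x)))
    (∣x∣≤ (subst (_≤ ∣ - x ∣) (-‿involutive x) (-x≤∣x∣ (- x))) (x≤∣x∣ (- x)))

  -- Serves to pass from a bound on twice the remainder to one on the remainder without a division.
  ∣x∣≤∣x+x∣ : ∀ x → ∣ x ∣ ≤ ∣ x + x ∣
  ∣x∣≤∣x+x∣ x with ∣∣-cases x
  ... | inj₁ (0≤x , ∣x∣≡x) = begin
    ∣ x ∣     ≡⟨ ∣x∣≡x ⟩
    x         ≤⟨ x≤x+y x 0≤x ⟩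
    x + x     ≤⟨ x≤∣x∣ (x + x) ⟩
    ∣ x + x ∣ ∎
  ... | inj₂ (0≤-x , ∣x∣≡-x) = begin
    ∣ x ∣     ≡⟨ ∣x∣≡-x ⟩
    - x       ≤⟨ x≤x+y (- x) 0≤-x ⟩
    - x + - x ≡⟨ solve 1 (λ x → :- x :+ :- x := :- (x :+ x)) refl x ⟩
    - (x + x) ≤⟨ -x≤∣x∣ (x + x) ⟩
    ∣ x + x ∣ ∎

  x≤y+∣x-y∣ : ∀ x y → x ≤ y + ∣ x - y ∣
  x≤y+∣x-y∣ x y = begin
    x               ≡⟨ solve 2 (λ x y → x := y :+ (x :- y)) refl x y ⟩
    y + (x - y)     ≤⟨ +-monoʳ-≤ y (x≤∣x∣ (x - y)) ⟩
    y + ∣ x - y ∣   ∎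

  -- The complex modulus, handled as a supremum.

  ‖‖-isLub : ∀ z → IsLub (λ t → t * t ≤ re z * re z + im z * im z) ‖ z ‖
  ‖‖-isLub z = proj₂ (√-lub _ (+-nonneg (square-nonneg (re z)) (square-nonneg (im z))))

  -- `∣ re z ∣` belongs to the set whose supremum is the modulus.
  ∣re∣≤‖‖ : ∀ z → ∣ re z ∣ ≤ ‖ z ‖
  ∣re∣≤‖‖ z = proj₁ (‖‖-isLub z) ∣ re z ∣
    (gap⇒≤ (im z * im z) (square-nonneg (im z))
      (cong (_+ im z * im z) (sym (∣x∣*∣x∣≡x*x (re z)))))

  ∣im∣≤‖‖ : ∀ z → ∣ im z ∣ ≤ ‖ z ‖
  ∣im∣≤‖‖ z = proj₁ (‖‖-isLub z) ∣ im z ∣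
    (gap⇒≤ (re z * re z) (square-nonneg (re z))
      (trans (+-comm _ _) (cong (_+ re z * re z) (sym (∣x∣*∣x∣≡x*x (im z))))))

  -- The right side bounds every member of the set defining the modulus, since its square exceeds
  -- re² + im² by 2 |re| |im|.
  ‖‖≤∣re∣+∣im∣ : ∀ z → ‖ z ‖ ≤ ∣ re z ∣ + ∣ im z ∣
  ‖‖≤∣re∣+∣im∣ z = proj₂ (‖‖-isLub z) _ λ t t²≤ →
    x*x≤y*y⇒x≤y (+-nonneg (0≤∣x∣ (re z)) (0≤∣x∣ (im z))) (≤-trans t²≤
      (gap⇒≤ ((1# + 1#) * (∣ re z ∣ * ∣ im z ∣))
        (*-nonneg (+-nonneg 0≤1 0≤1) (*-nonneg (0≤∣x∣ (re z)) (0≤∣x∣ (im z))))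
        (trans
          (solve 2 (λ u v → (u :+ v) :* (u :+ v)
              := (u :* u :+ v :* v) :+ con (+ 2) :* (u :* v))
            refl ∣ re z ∣ ∣ im z ∣)
          (cong (_+ (1# + 1#) * (∣ re z ∣ * ∣ im z ∣))
            (cong₂ _+_ (∣x∣*∣x∣≡x*x (re z)) (∣x∣*∣x∣≡x*x (im z)))))))

-- Concatenation of tagged partitions and existence of fine left-tagged ones.

module Partitions {ℓ} (R : RealField ℓ) where
  open Analysis R
  open OrderedFieldProperties R
  open IntegerCoefficients commutativeRing
    using (solve; con; _:=_; _:+_; _:*_; _:-_)
  open PartialOrderReasoning ≤-poset

  -- Left tags are chosen because the increment of `Φ` over a cell involves the remainder at the
  -- left endpoint.
  LeftTagged : ∀ {a b} → TaggedPartition b a → Set ℓ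
  LeftTagged         done             = ⊤
  LeftTagged {a = a} (cell t m _ _ P) = t ≡ a × LeftTagged P

  partition⇒≤ : ∀ {a b} → TaggedPartition b a → a ≤ b
  partition⇒≤ done                 = ≤-refl
  partition⇒≤ (cell _ _ a≤t t≤m P) = ≤-trans a≤t (≤-trans t≤m (partition⇒≤ P))

  _++_ : ∀ {a m b} → TaggedPartition m a → TaggedPartition b m → TaggedPartition b a
  done                 ++ Q = Q
  cell t m a≤t t≤m P   ++ Q = cell t m a≤t t≤m (P ++ Q)

  ++-mesh : ∀ {δ a m b} (P : TaggedPartition m a) (Q : TaggedPartition b m) →
            MeshAtMost δ P → MeshAtMost δ Q → MeshAtMost δ (P ++ Q)
  ++-mesh done             Q _            Q≤δ = Q≤δ
  ++-mesh (cell _ _ _ _ P) Q (m-a≤δ , P≤δ) Q≤δ = m-a≤δ , ++-mesh P Q P≤δ Q≤δ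

  ++-riemannSum : ∀ g {a m b} (P : TaggedPartition m a) (Q : TaggedPartition b m) →
                  riemannSum g (P ++ Q) ≡ riemannSum g P + riemannSum g Q
  ++-riemannSum g done Q = sym (+-identityˡ _)
  ++-riemannSum g {a = a} (cell t m _ _ P) Q =
    trans (cong (_+_ (g t * (m - a))) (++-riemannSum g P Q)) (sym (+-assoc _ _ _))

  mesh-weaken : ∀ {δ δ′ a b} (P : TaggedPartition b a) → δ ≤ δ′ →
                MeshAtMost δ P → MeshAtMost δ′ P
  mesh-weaken done             δ≤δ′ _             = tt
  mesh-weaken (cell _ _ _ _ P) δ≤δ′ (m-a≤δ , P≤δ) =
    ≤-trans m-a≤δ δ≤δ′ , mesh-weaken P δ≤δ′ P≤δ

  FinePartition : ℝ → ℝ → ℝ → Set ℓ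
  FinePartition δ a b = ∃ λ (P : TaggedPartition b a) → MeshAtMost δ P × LeftTagged P

  -- Cells of length exactly δ are split off until the rest fits into one cell. The number j bounds
  -- the steps still available and drives the recursion; at j = 0 the endpoints coincide.
  finePartition-steps : ∀ {δ} → 0# ≤ δ → ∀ j {a b} → a ≤ b → b ≤ a + fromℕ j * δ →
                        FinePartition δ a b
  finePartition-steps {δ} 0≤δ zero {a} {b} a≤b b≤a+0 =
    subst (FinePartition δ a) (antisym a≤b b≤a) (done , tt , tt)
    where
    b≤a : b ≤ a
    b≤a = subst (b ≤_) (trans (cong (_+_ a) (zeroˡ δ)) (+-identityʳ a)) b≤a+0
  finePartition-steps {δ} 0≤δ (suc j) {a} {b} a≤b b≤ with b ≤? a + δ
  ... | yes b≤a+δ = cell a b ≤-refl a≤b done , (b-a≤δ , tt) , refl , tt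
    where
    b-a≤δ : b - a ≤ δ
    b-a≤δ = gap⇒≤ (a + δ - b) (0≤y-x b≤a+δ)
      (solve 3 (λ a b δ → δ := (b :- a) :+ (a :+ δ :- b)) refl a b δ)
  ... | no b≰a+δ
    with finePartition-steps 0≤δ j (≰⇒≥ b≰a+δ) (subst (b ≤_) regroup b≤)
    where
    regroup : a + fromℕ (suc j) * δ ≡ a + δ + fromℕ j * δ
    regroup = solve 3 (λ a n δ → a :+ (con (+ 1) :+ n) :* δ := a :+ δ :+ n :* δ)
      refl a (fromℕ j) δ
  ... | P , P≤δ , P-left =
    cell a (a + δ) ≤-refl (x≤x+y a 0≤δ) P , (a+δ-a≤δ , P≤δ) , refl , P-left
    where
    a+δ-a≤δ : a + δ - a ≤ δ
    a+δ-a≤δ = subst (_≤ δ) (solve 2 (λ a δ → δ := a :+ δ :- a) refl a δ) ≤-refl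

  finePartition : ∀ {δ} → 0# < δ → ∀ {a b} → a ≤ b → FinePartition δ a b
  finePartition {δ} (0≤δ , 0≢δ) {a} {b} a≤b =
    -- The number of steps is a natural number at least (b - a) / δ.
    let j , [b-a]/δ≤j = archimedean ((b - a) / δ) in
    finePartition-steps 0≤δ j a≤b (begin
      b                      ≡⟨ solve 2 (λ a b → b := a :+ (b :- a)) refl a b ⟩
      a + (b - a)            ≡⟨ cong (_+_ a) (*-identityʳ (b - a)) ⟨
      a + (b - a) * 1#       ≡⟨ cong (λ u → a + (b - a) * u)
                                  (⁻¹-inverse δ (λ δ≡0 → 0≢δ (sym δ≡0))) ⟨
      a + (b - a) * (δ * δ ⁻¹) ≡⟨ solve 4 (λ a d δ δ⁻¹ → a :+ d :* (δ :* δ⁻¹)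
                                    := a :+ d :* δ⁻¹ :* δ) refl a (b - a) δ (δ ⁻¹) ⟩
      a + (b - a) / δ * δ    ≤⟨ +-monoʳ-≤ a (*-monoˡ-≤ 0≤δ [b-a]/δ≤j) ⟩
      a + fromℕ j * δ        ∎)

-- Real sums over n ≤ x and their behaviour between consecutive integers.

module RealSummation {ℓ} (R : RealField ℓ) where
  open Analysis R
  open OrderedFieldProperties R
  open IntegerCoefficients commutativeRing
    using (solve; con; _:=_; _:+_; _:*_; _:-_)
  open RawMonoidDefs +-rawMonoid using (sum)
  open ≡-Reasoning

  truncate : ℝ → ℕ → ℝ → ℝ
  truncate x n v = if ⌊ fromℕ n ≤? x ⌋ then v else 0#

  truncate-≰ : ∀ {x} n {v} → ¬ (fromℕ n ≤ x) → truncate x n v ≡ 0#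
  truncate-≰ {x} n n≰x with fromℕ n ≤? x
  ... | yes n≤x = contradiction n≤x n≰x
  ... | no  _   = refl

  -- The arithmetic function n ↦ v (n − 1), summed over 1 ≤ n ≤ min(x, L).
  partialSum : ℝ → ℕ → (ℕ → ℝ) → ℝ
  partialSum x L v = sum {L} λ k → truncate x (suc (toℕ k)) (v (toℕ k))

  sum-tail-zero : ∀ {N L} → N ℕ.≤ L → (t : ℕ → ℝ) → (∀ k → N ℕ.≤ k → t k ≡ 0#) →
                  sum {L} (λ k → t (toℕ k)) ≡ sum {N} (λ k → t (toℕ k))
  sum-tail-zero {L = zero}  ℕ.z≤n t t≡0 = refl
  sum-tail-zero {L = suc L} ℕ.z≤n t t≡0 = trans
    (cong₂ _+_ (t≡0 0 ℕ.z≤n)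
      (sum-tail-zero {L = L} ℕ.z≤n (λ k → t (suc k)) (λ k _ → t≡0 (suc k) ℕ.z≤n)))
    (+-identityʳ 0#)
  sum-tail-zero (ℕ.s≤s N≤L) t t≡0 =
    cong (_+_ (t 0)) (sum-tail-zero N≤L (λ k → t (suc k)) (λ k N≤k → t≡0 (suc k) (ℕ.s≤s N≤k)))

  sum≤ : ℝ → (ℕ → ℝ) → ℝ
  sum≤ x v = partialSum x (proj₁ (archimedean x)) v

  -- The cutoff supplied by `archimedean` depends on x. Terms beyond it have index greater than x
  -- and vanish, so sums at different points can be compared over one common range.
  sum≤≡partialSum : ∀ x {L} v → proj₁ (archimedean x) ℕ.≤ L →
                    sum≤ x v ≡ partialSum x L v
  sum≤≡partialSum x v N≤L = sym (sum-tail-zero N≤L (λ k → truncate x (suc k) (v k))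
    λ k N≤k → truncate-≰ (suc k) λ 1+k≤x → suc-fromℕ≰ k
      (≤-trans 1+k≤x (≤-trans (proj₂ (archimedean x)) (fromℕ-mono-≤ N≤k))))

  -- Either end may itself be an integer; a jump of the sums at the right end is harmless by
  -- `weighted-truncate`.
  NoIntegerInside : ℝ → ℝ → Set ℓ
  NoIntegerInside a b = ∀ n → fromℕ n ≤ a ⊎ b ≤ fromℕ n

  -- An integer n = m entering the sums contributes m v − n v = 0.
  weighted-truncate : ∀ {a m} → a ≤ m → NoIntegerInside a m → ∀ n v →
    m * truncate m n v - truncate m n (fromℕ n * v) ≡
    m * truncate a n v - truncate a n (fromℕ n * v)
  weighted-truncate {a} {m} a≤m gap n v with fromℕ n ≤? m | fromℕ n ≤? a
  ... | yes _   | yes _   = refl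
  ... | no  _   | no  _   = refl
  ... | no  n≰m | yes n≤a = contradiction (≤-trans n≤a a≤m) n≰m
  ... | yes n≤m | no  n≰a with gap n
  ...   | inj₁ n≤a = contradiction n≤a n≰a
  ...   | inj₂ m≤n = begin
    m * v - fromℕ n * v ≡⟨ cong (λ u → m * v - u * v) (antisym n≤m m≤n) ⟩
    m * v - m * v       ≡⟨ solve 2 (λ m v → m :* v :- m :* v := m :* con (+ 0) :- con (+ 0)) refl m v ⟩
    m * 0# - 0#         ∎

  weighted-sum : ∀ m L {u v u′ v′ : Fin L → ℝ} →
    (∀ k → m * u k - v k ≡ m * u′ k - v′ k) →
    m * sum u - sum v ≡ m * sum u′ - sum v′
  weighted-sum m zero eq = refl
  weighted-sum m (suc L) {u} {v} {u′} {v′} eq = begin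
    m * (u zero + sum (λ k → u (suc k))) - (v zero + sum (λ k → v (suc k)))
      ≡⟨ split m _ _ _ _ ⟩
    (m * u zero - v zero) + (m * sum (λ k → u (suc k)) - sum (λ k → v (suc k)))
      ≡⟨ cong₂ _+_ (eq zero) (weighted-sum m L (λ k → eq (suc k))) ⟩
    (m * u′ zero - v′ zero) + (m * sum (λ k → u′ (suc k)) - sum (λ k → v′ (suc k)))
      ≡⟨ split m _ _ _ _ ⟨
    m * (u′ zero + sum (λ k → u′ (suc k))) - (v′ zero + sum (λ k → v′ (suc k)))
      ∎
    where
    split : ∀ m a b c d → m * (a + b) - (c + d) ≡ (m * a - c) + (m * b - d)
    split = solve 5 (λ m a b c d →
      m :* (a :+ b) :- (c :+ d) := (m :* a :- c) :+ (m :* b :- d)) refl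

  -- The left side is the sum of (m - n) times the n-th term, where n = m has weight zero. Hence
  -- both sums may be frozen at their values at a.
  weighted-sum≤ : ∀ {a m} → a ≤ m → NoIntegerInside a m → (φ : ℕ → ℝ) →
    let ψ = λ k → fromℕ (suc k) * φ k in
    m * sum≤ m φ - sum≤ m ψ ≡ m * sum≤ a φ - sum≤ a ψ
  weighted-sum≤ {a} {m} a≤m gap φ = begin
    m * sum≤ m φ - sum≤ m ψ
      ≡⟨ cong₂ (λ s t → m * s - t) (sum≤≡partialSum m φ Nₘ≤L) (sum≤≡partialSum m ψ Nₘ≤L) ⟩
    m * partialSum m L φ - partialSum m L ψ
      ≡⟨ weighted-sum m L (λ k → weighted-truncate a≤m gap (suc (toℕ k)) (φ (toℕ k))) ⟩
    m * partialSum a L φ - partialSum a L ψ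
      ≡⟨ cong₂ (λ s t → m * s - t) (sum≤≡partialSum a φ Nₐ≤L) (sum≤≡partialSum a ψ Nₐ≤L) ⟨
    m * sum≤ a φ - sum≤ a ψ ∎
    where
    ψ : ℕ → ℝ
    ψ k = fromℕ (suc k) * φ k
    -- A common length that dominates both cutoffs.
    L : ℕ
    L = proj₁ (archimedean a) ℕ.+ proj₁ (archimedean m)
    Nₐ≤L : proj₁ (archimedean a) ℕ.≤ L
    Nₐ≤L = ℕ.m≤m+n _ _
    Nₘ≤L : proj₁ (archimedean m) ℕ.≤ L
    Nₘ≤L = ℕ.m≤n+m _ _

-- Bounding twice the integral of a real remainder by the integral of g.

module RemainderBound {ℓ} (R : RealField ℓ) where
  open Analysis R
  open OrderedFieldProperties R
  open Partitions R
  open RealSummation R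
  open IntegerCoefficients commutativeRing
    using (solve; con; _:=_; _:+_; _:*_; _:-_; :-_)
  open PartialOrderReasoning ≤-poset

  2# : ℝ
  2# = 1# + 1#

  0≤2 : 0# ≤ 2#
  0≤2 = +-nonneg 0≤1 0≤1

  module Estimate (φ : ℕ → ℝ) (c : ℝ) (e : ℝ → ℝ)
    (sum≤-φ : ∀ x → sum≤ x φ ≡ c * x + e x) where

    weightedSum≤ : ℝ → ℝ
    weightedSum≤ x = sum≤ x (λ k → fromℕ (suc k) * φ k)

    -- By partial summation Φ x = 2 ∫₀ˣ e(t) dt.
    Φ : ℝ → ℝ
    Φ x = 2# * (x * sum≤ x φ - weightedSum≤ x) - c * (x * x)

    -- Before m the summatory function keeps its value c a + e(a), so e(t) = e(a) - c (t - a) there;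
    -- twice its integral from a to m is the right side.
    Φ-increment : ∀ {a m} → a ≤ m → NoIntegerInside a m →
                  Φ m - Φ a ≡ (m - a) * (2# * e a - c * (m - a))
    Φ-increment {a} {m} a≤m gap = begin-equality
      Φ m - Φ a
        ≡⟨ cong (λ u → 2# * u - c * (m * m) - Φ a) (weighted-sum≤ a≤m gap φ) ⟩
      2# * (m * s - t) - c * (m * m) - (2# * (a * s - t) - c * (a * a))
        ≡⟨ cong (λ s → 2# * (m * s - t) - c * (m * m) - (2# * (a * s - t) - c * (a * a)))
             (sum≤-φ a) ⟩
      2# * (m * (c * a + e a) - t) - c * (m * m) - (2# * (a * (c * a + e a) - t) - c * (a * a))
        ≡⟨ solve 5 (λ a m c e t →
             con (+ 2) :* (m :* (c :* a :+ e) :- t) :- c :* (m :* m)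
               :- (con (+ 2) :* (a :* (c :* a :+ e) :- t) :- c :* (a :* a))
             := (m :- a) :* (con (+ 2) :* e :- c :* (m :- a)))
             refl a m c (e a) t ⟩
      (m - a) * (2# * e a - c * (m - a)) ∎
      where
      s t : ℝ
      s = sum≤ a φ
      t = weightedSum≤ a

    module _ (g G : ℝ → ℝ) (A x₀ : ℝ) (0≤A : 0# ≤ A)
      (e-bound : ∀ x → x₀ ≤ x → ∣ e x ∣ ≤ A * g x)
      (G-integral : ∀ x → 1# ≤ x → IsRiemannIntegral g 1# x (G x)) where

      -- The last term collects the quadratic parts c (m - a)² of the increments: each is at most
      -- |c| δ (m - a) in size on a cell of length at most δ. The bound is additive under
      -- concatenation.
      Controls : ∀ {a b} → ℝ → TaggedPartition b a → Set ℓ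
      Controls {a} {b} δ P = ∣ Φ b - Φ a ∣ ≤ 2# * A * riemannSum g P + ∣ c ∣ * δ * (b - a)

      Φ-increment-bound : ∀ {δ a m} → x₀ ≤ a → a ≤ m → NoIntegerInside a m → m - a ≤ δ →
        ∣ Φ m - Φ a ∣ ≤ 2# * A * (g a * (m - a)) + ∣ c ∣ * δ * (m - a)
      Φ-increment-bound {δ} {a} {m} x₀≤a a≤m gap m-a≤δ = begin
        ∣ Φ m - Φ a ∣
          ≡⟨ cong ∣_∣ (Φ-increment a≤m gap) ⟩
        ∣ (m - a) * (2# * e a - c * (m - a)) ∣
          ≡⟨ ∣x*y∣≡∣x∣*∣y∣ _ _ ⟩
        ∣ m - a ∣ * ∣ 2# * e a - c * (m - a) ∣
          ≡⟨ cong (_* ∣ 2# * e a - c * (m - a) ∣) (0≤x⇒∣x∣≡x 0≤m-a) ⟩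
        (m - a) * ∣ 2# * e a - c * (m - a) ∣
          ≤⟨ *-monoʳ-≤ 0≤m-a factor-bound ⟩
        (m - a) * (2# * (A * g a) + ∣ c ∣ * δ)
          ≡⟨ solve 5 (λ d A g c δ → d :* (con (+ 2) :* (A :* g) :+ c :* δ)
               := con (+ 2) :* A :* (g :* d) :+ c :* δ :* d) refl (m - a) A (g a) ∣ c ∣ δ ⟩
        2# * A * (g a * (m - a)) + ∣ c ∣ * δ * (m - a) ∎
        where
        0≤m-a : 0# ≤ m - a
        0≤m-a = 0≤y-x a≤m
        factor-bound : ∣ 2# * e a - c * (m - a) ∣ ≤ 2# * (A * g a) + ∣ c ∣ * δ
        factor-bound = begin
          ∣ 2# * e a - c * (m - a) ∣
            ≤⟨ ∣x+y∣≤∣x∣+∣y∣ _ _ ⟩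
          ∣ 2# * e a ∣ + ∣ - (c * (m - a)) ∣
            ≡⟨ cong (_+_ ∣ 2# * e a ∣) (∣-x∣≡∣x∣ _) ⟩
          ∣ 2# * e a ∣ + ∣ c * (m - a) ∣
            ≡⟨ cong₂ _+_ (∣x*y∣≡∣x∣*∣y∣ _ _) (∣x*y∣≡∣x∣*∣y∣ _ _) ⟩
          ∣ 2# ∣ * ∣ e a ∣ + ∣ c ∣ * ∣ m - a ∣
            ≡⟨ cong₂ (λ u v → u * ∣ e a ∣ + ∣ c ∣ * v) (0≤x⇒∣x∣≡x 0≤2) (0≤x⇒∣x∣≡x 0≤m-a) ⟩
          2# * ∣ e a ∣ + ∣ c ∣ * (m - a)
            ≤⟨ +-mono-≤ (*-monoʳ-≤ 0≤2 (e-bound a x₀≤a)) (*-monoʳ-≤ (0≤∣x∣ c) m-a≤δ) ⟩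
          2# * (A * g a) + ∣ c ∣ * δ ∎

      ++-controls : ∀ {δ a m b} (P : TaggedPartition m a) (Q : TaggedPartition b m) →
                    Controls δ P → Controls δ Q → Controls δ (P ++ Q)
      ++-controls {δ} {a} {m} {b} P Q P-controls Q-controls = begin
        ∣ Φ b - Φ a ∣
          ≡⟨ cong ∣_∣ (solve 3 (λ x y z → z :- x := (y :- x) :+ (z :- y)) refl (Φ a) (Φ m) (Φ b)) ⟩
        ∣ (Φ m - Φ a) + (Φ b - Φ m) ∣
          ≤⟨ ∣x+y∣≤∣x∣+∣y∣ _ _ ⟩
        ∣ Φ m - Φ a ∣ + ∣ Φ b - Φ m ∣
          ≤⟨ +-mono-≤ P-controls Q-controls ⟩
        2# * A * p + ∣ c ∣ * δ * (m - a) + (2# * A * q + ∣ c ∣ * δ * (b - m))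
          ≡⟨ solve 7 (λ a m b A p q k →
               A :* p :+ k :* (m :- a) :+ (A :* q :+ k :* (b :- m))
               := A :* (p :+ q) :+ k :* (b :- a))
               refl a m b (2# * A) p q (∣ c ∣ * δ) ⟩
        2# * A * (p + q) + ∣ c ∣ * δ * (b - a)
          ≡⟨ cong (λ r → 2# * A * r + ∣ c ∣ * δ * (b - a)) (++-riemannSum g P Q) ⟨
        2# * A * riemannSum g (P ++ Q) + ∣ c ∣ * δ * (b - a) ∎
        where
        p q : ℝ
        p = riemannSum g P
        q = riemannSum g Q

      done-controls : ∀ {δ a} → Controls δ (done {b = a})
      done-controls {δ} {a} = begin
        ∣ Φ a - Φ a ∣   ≡⟨ cong ∣_∣ (-‿inverseʳ (Φ a)) ⟩
        ∣ 0# ∣          ≡⟨ 0≤x⇒∣x∣≡x ≤-refl ⟩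
        0#              ≡⟨ solve 3 (λ A k a → con (+ 0) := A :* con (+ 0) :+ k :* (a :- a))
                             refl (2# * A) (∣ c ∣ * δ) a ⟩
        2# * A * 0# + ∣ c ∣ * δ * (a - a) ∎

      -- The first cell is treated as a partition of its own, bounded by the explicit increment, and
      -- joined to the rest; both pieces inherit the absence of interior integers.
      leftTagged-controls : ∀ {δ a b} (P : TaggedPartition b a) → LeftTagged P → MeshAtMost δ P →
                            NoIntegerInside a b → x₀ ≤ a → Controls δ P
      leftTagged-controls done _ _ _ _ = done-controls
      leftTagged-controls {δ} {a} {b} (cell t m a≤a a≤m P) (refl , P-left) (m-a≤δ , P≤δ) gap x₀≤a =
        ++-controls (cell a m a≤a a≤m done) P
          -- The Riemann sum of a single cell carries a trailing `0#` from `done`.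
          (subst (λ r → ∣ Φ m - Φ a ∣ ≤ 2# * A * r + ∣ c ∣ * δ * (m - a)) (sym (+-identityʳ _))
            (Φ-increment-bound x₀≤a a≤m gap-left m-a≤δ))
          (leftTagged-controls P P-left P≤δ gap-right (≤-trans x₀≤a a≤m))
        where
        gap-left : NoIntegerInside a m
        gap-left n with gap n
        ... | inj₁ n≤a = inj₁ n≤a
        ... | inj₂ b≤n = inj₂ (≤-trans (partition⇒≤ P) b≤n)
        gap-right : NoIntegerInside m b
        gap-right n with gap n
        ... | inj₁ n≤a = inj₁ (≤-trans n≤a a≤m)
        ... | inj₂ b≤n = inj₂ b≤n

      ControllingPartition : ℝ → ℝ → ℝ → Set ℓ
      ControllingPartition δ a b =
        ∃ λ (P : TaggedPartition b a) → MeshAtMost δ P × Controls δ P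

      -- Induction over the unit intervals from M to b. Each integer on the way becomes a division
      -- point, so no cell has an integer in its interior.
      controllingPartition : ∀ {δ} → 0# < δ → ∀ {M} → x₀ ≤ fromℕ M → ∀ j {b} →
        fromℕ M ≤ b → b ≤ fromℕ (j ℕ.+ M) → ControllingPartition δ (fromℕ M) b
      controllingPartition {δ} 0<δ {M} x₀≤M zero M≤b b≤M =
        subst (ControllingPartition δ (fromℕ M)) (antisym M≤b b≤M) (done , tt , done-controls)
      controllingPartition {δ} 0<δ {M} x₀≤M (suc j) {b} M≤b b≤1+j+M with b ≤? fromℕ (j ℕ.+ M)
      ... | yes b≤j+M = controllingPartition 0<δ x₀≤M j M≤b b≤j+M
      ... | no  b≰j+M
        with controllingPartition 0<δ x₀≤M j M≤j+M ≤-refl | finePartition 0<δ (≰⇒≥ b≰j+M)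
        where
        M≤j+M : fromℕ M ≤ fromℕ (j ℕ.+ M)
        M≤j+M = fromℕ-mono-≤ (ℕ.m≤n+m M j)
      ... | P , P≤δ , P-controls | Q , Q≤δ , Q-left =
        P ++ Q , ++-mesh P Q P≤δ Q≤δ , ++-controls P Q P-controls
          (leftTagged-controls Q Q-left Q≤δ gap
            (≤-trans x₀≤M (fromℕ-mono-≤ (ℕ.m≤n+m M j))))
        where
        -- An integer beyond j + M is at least 1 + j + M, hence at least b.
        gap : NoIntegerInside (fromℕ (j ℕ.+ M)) b
        gap n with n ℕ.≤? j ℕ.+ M
        ... | yes n≤j+M = inj₁ (fromℕ-mono-≤ n≤j+M)
        ... | no  n≰j+M = inj₂ (≤-trans b≤1+j+M (fromℕ-mono-≤ (ℕ.≰⇒> n≰j+M)))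

      -- Subtracting the integral over [1 , M], where g may be negative, from that over
      -- [1 , x] costs only a constant.
      Φ-bound : ∀ {M} → 1# ≤ fromℕ M → x₀ ≤ fromℕ M → ∃ λ C → 0# ≤ C ×
        (∀ x → fromℕ M ≤ x → ∣ Φ x ∣ ≤ 2# * A * ∣ G x ∣ + C)
      Φ-bound {M} 1≤M x₀≤M = C , 0≤C , bound
        where
        r C : ℝ
        r = fromℕ M
        -- The constant gathers the value of `Φ` at M, the integral up to M together with two
        -- approximation errors of size 1, and the total mesh error.
        C = ∣ Φ r ∣ + 2# * A * (∣ G r ∣ + 2#) + ∣ c ∣
        0≤2A : 0# ≤ 2# * A
        0≤2A = *-nonneg 0≤2 0≤A
        0≤C : 0# ≤ C
        0≤C = +-nonneg (+-nonneg (0≤∣x∣ _) (*-nonneg 0≤2A (+-nonneg (0≤∣x∣ _) 0≤2))) (0≤∣x∣ c)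
        -- The sums over P and P ++ Q lie within 1 of G r and G x, so their difference, the sum over
        -- Q, is at most G x - G r + 2.
        bound-via : ∀ {δ x} → r ≤ x → 0# < δ → δ ≤ x ⁻¹ →
          (P : TaggedPartition r 1#) → ∣ riemannSum g P - G r ∣ ≤ 1# →
          (Q : TaggedPartition x r) → ∣ riemannSum g (P ++ Q) - G x ∣ ≤ 1# →
          Controls δ Q → ∣ Φ x ∣ ≤ 2# * A * ∣ G x ∣ + C
        bound-via {δ} {x} r≤x 0<δ δ≤x⁻¹ P near-r Q near-x Q-controls = begin
          ∣ Φ x ∣
            ≡⟨ cong ∣_∣ (solve 2 (λ y z → z := y :+ (z :- y)) refl (Φ r) (Φ x)) ⟩
          ∣ Φ r + (Φ x - Φ r) ∣
            ≤⟨ ∣x+y∣≤∣x∣+∣y∣ _ _ ⟩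
          ∣ Φ r ∣ + ∣ Φ x - Φ r ∣
            ≤⟨ +-monoʳ-≤ _ Q-controls ⟩
          ∣ Φ r ∣ + (2# * A * q + ∣ c ∣ * δ * (x - r))
            ≤⟨ +-monoʳ-≤ _ (+-mono-≤ (*-monoʳ-≤ 0≤2A q-bound) mesh-term) ⟩
          ∣ Φ r ∣ + (2# * A * (∣ G x ∣ + (∣ G r ∣ + 2#)) + ∣ c ∣)
            ≡⟨ solve 5 (λ φ A u v k → φ :+ (A :* (u :+ v) :+ k) := A :* u :+ (φ :+ A :* v :+ k))
                 refl (∣ Φ r ∣) (2# * A) (∣ G x ∣) (∣ G r ∣ + 2#) (∣ c ∣) ⟩
          2# * A * ∣ G x ∣ + C ∎
          where
          p q : ℝ
          p = riemannSum g P
          q = riemannSum g Q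

          p-lower : G r ≤ p + 1#
          p-lower = begin
            G r                 ≤⟨ x≤y+∣x-y∣ (G r) p ⟩
            p + ∣ G r - p ∣     ≡⟨ cong (_+_ p) (trans (sym (∣-x∣≡∣x∣ _))
                                    (cong ∣_∣ (solve 2 (λ u v → :- (u :- v) := v :- u) refl (G r) p))) ⟩
            p + ∣ p - G r ∣     ≤⟨ +-monoʳ-≤ p near-r ⟩
            p + 1# ∎

          p+q-upper : p + q ≤ G x + 1#
          p+q-upper = begin
            p + q                             ≡⟨ ++-riemannSum g P Q ⟨
            riemannSum g (P ++ Q)             ≤⟨ x≤y+∣x-y∣ _ (G x) ⟩
            G x + ∣ riemannSum g (P ++ Q) - G x ∣
              ≤⟨ +-monoʳ-≤ (G x) near-x ⟩
            G x + 1# ∎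

          q-bound : q ≤ ∣ G x ∣ + (∣ G r ∣ + 2#)
          q-bound = begin
            q
              ≡⟨ solve 3 (λ p q u → q := (p :+ q) :+ u :+ (:- u :- p)) refl p q (G r) ⟩
            (p + q) + G r + (- G r - p)
              ≤⟨ +-mono-≤ (+-mono-≤ p+q-upper p-lower) ≤-refl ⟩
            (G x + 1#) + (p + 1#) + (- G r - p)
              ≡⟨ solve 3 (λ p u v → (v :+ con (+ 1)) :+ (p :+ con (+ 1)) :+ (:- u :- p)
                   := v :+ (:- u :+ con (+ 2))) refl p (G r) (G x) ⟩
            G x + (- G r + 2#)
              ≤⟨ +-mono-≤ (x≤∣x∣ (G x)) (+-mono-≤ (-x≤∣x∣ (G r)) ≤-refl) ⟩
            ∣ G x ∣ + (∣ G r ∣ + 2#) ∎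

          0≤x : 0# ≤ x
          0≤x = 1≤x⇒0≤x (≤-trans 1≤M r≤x)

          -- Because δ ≤ 1/x, the mesh errors over a length of at most x add up to at most |c|,
          -- uniformly in x.
          mesh-term : ∣ c ∣ * δ * (x - r) ≤ ∣ c ∣
          mesh-term = begin
            ∣ c ∣ * δ * (x - r)
              ≤⟨ *-monoʳ-≤ (*-nonneg (0≤∣x∣ c) (proj₁ 0<δ))
                   (gap⇒≤ r (fromℕ-nonneg M) (solve 2 (λ x r → x := (x :- r) :+ r) refl x r)) ⟩
            ∣ c ∣ * δ * x
              ≤⟨ *-monoˡ-≤ 0≤x (*-monoʳ-≤ (0≤∣x∣ c) δ≤x⁻¹) ⟩
            ∣ c ∣ * x ⁻¹ * x
              ≡⟨ solve 3 (λ c x y → c :* y :* x := c :* (x :* y)) refl (∣ c ∣) x (x ⁻¹) ⟩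
            ∣ c ∣ * (x * x ⁻¹)
              ≡⟨ cong (∣ c ∣ *_) (⁻¹-inverse x (1≤x⇒x≢0 (≤-trans 1≤M r≤x))) ⟩
            ∣ c ∣ * 1#
              ≡⟨ *-identityʳ _ ⟩
            ∣ c ∣ ∎

        bound : ∀ x → r ≤ x → ∣ Φ x ∣ ≤ 2# * A * ∣ G x ∣ + C
        bound x r≤x =
          -- Tolerance 1 is enough for a bounded error. One mesh δ serves both integrals and is also
          -- kept below 1/x.
          let δ₁ , 0<δ₁ , near-r = G-integral r 1≤M 1# 0<1
              δ₂ , 0<δ₂ , near-x = G-integral x (≤-trans 1≤M r≤x) 1# 0<1
              δ₃ , 0<δ₃ , δ₃≤δ₁ , δ₃≤δ₂ = positive-lower-bound 0<δ₁ 0<δ₂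
              1≤x = ≤-trans 1≤M r≤x
              δ , 0<δ , δ≤δ₃ , δ≤x⁻¹ =
                positive-lower-bound 0<δ₃ (⁻¹-pos (1≤x⇒0≤x 1≤x) (1≤x⇒x≢0 1≤x))
              P , P≤δ , _ = finePartition 0<δ 1≤M
              j , x≤j = archimedean x
              Q , Q≤δ , Q-controls = controllingPartition 0<δ x₀≤M j r≤x
                (≤-trans x≤j (fromℕ-mono-≤ (ℕ.m≤m+n j M)))
          in bound-via r≤x 0<δ δ≤x⁻¹
               P (near-r P (mesh-weaken P (≤-trans δ≤δ₃ δ₃≤δ₁) P≤δ))
               Q (near-x (P ++ Q)
                   (mesh-weaken (P ++ Q) (≤-trans δ≤δ₃ δ₃≤δ₂) (++-mesh P Q P≤δ Q≤δ)))
               Q-controls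

-- From real coordinates to the complex remainder, and the Landau-symbol estimates.

module ComplexRemainder {ℓ} (R : RealField ℓ) where
  open Analysis R
  open OrderedFieldProperties R
  open RealSummation R
  open RemainderBound R using (2#; module Estimate)
  open IntegerCoefficients commutativeRing
    using (solve; con; _:=_; _:+_; _:*_; _:-_; :-_)
  open PartialOrderReasoning ≤-poset
  open RawMonoidDefs +-rawMonoid using (sum)
  open RawMonoidDefs ℂ-+-rawMonoid using () renaming (sum to sumℂ)

  -- Treats `re` and `im` uniformly. Products occur only with a real factor, on the left or on the
  -- right, where each coordinate is linear.
  record IsCoordinate (π : ℂ → ℝ) : Set ℓ where
    field
      +-homo    : ∀ z w → π (z +ℂ w) ≡ π z + π w
      -‿homo    : ∀ z w → π (z -ℂ w) ≡ π z - π w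
      0-homo    : π 0ℂ ≡ 0#
      ofℝ*-homo : ∀ x z → π (ofℝ x *ℂ z) ≡ x * π z
      *ofℝ-homo : ∀ z x → π (z *ℂ ofℝ x) ≡ π z * x
      ∣∣≤‖‖     : ∀ z → ∣ π z ∣ ≤ ‖ z ‖

  re-isCoordinate : IsCoordinate re
  re-isCoordinate = record
    { +-homo    = λ _ _ → refl
    ; -‿homo    = λ _ _ → refl
    ; 0-homo    = refl
    ; ofℝ*-homo = λ x z → solve 3 (λ x a b → x :* a :- con (+ 0) :* b := x :* a)
                            refl x (re z) (im z)
    ; *ofℝ-homo = λ z x → solve 3 (λ x a b → a :* x :- b :* con (+ 0) := a :* x)
                            refl x (re z) (im z)
    ; ∣∣≤‖‖     = ∣re∣≤‖‖
    }

  im-isCoordinate : IsCoordinate im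
  im-isCoordinate = record
    { +-homo    = λ _ _ → refl
    ; -‿homo    = λ _ _ → refl
    ; 0-homo    = refl
    ; ofℝ*-homo = λ x z → solve 3 (λ x a b → x :* b :+ con (+ 0) :* a := x :* b)
                            refl x (re z) (im z)
    ; *ofℝ-homo = λ z x → solve 3 (λ x a b → a :* con (+ 0) :+ b :* x := b :* x)
                            refl x (re z) (im z)
    ; ∣∣≤‖‖     = ∣im∣≤‖‖
    }

  module _ (f : ArithmeticFunction) (c : ℂ) (E : ℝ → ℂ) where

    nf : ArithmeticFunction
    nf n = ofℝ (fromℕ n) *ℂ f n

    -- By partial summation this is minus the integral of E over [0 , x].
    remainder : ℝ → ℂ
    remainder x = ∑≤ x nf -ℂ (c *ℂ ofℝ (x * x / (1# + 1#)) +ℂ ofℝ x *ℂ E x)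

    module Coordinate {π : ℂ → ℝ} (π-isCoordinate : IsCoordinate π)
      (∑≤-f : ∀ x → ∑≤ x f ≡ c *ℂ ofℝ x +ℂ E x) where
      open IsCoordinate π-isCoordinate

      sum-homo : ∀ L {t : Fin L → ℂ} {u : Fin L → ℝ} → (∀ k → π (t k) ≡ u k) →
                 π (sumℂ t) ≡ sum u
      sum-homo zero    eq = 0-homo
      sum-homo (suc L) eq =
        trans (+-homo _ _) (cong₂ _+_ (eq zero) (sum-homo L (λ k → eq (suc k))))

      ∑≤-homo : ∀ x (h : ArithmeticFunction) → π (∑≤ x h) ≡ sum≤ x (λ k → π (h (suc k)))
      ∑≤-homo x h = sum-homo (proj₁ (archimedean x)) λ k → truncate-homo (suc (toℕ k)) (h (suc (toℕ k)))
        where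
        truncate-homo : ∀ n z → π (if ⌊ fromℕ n ≤? x ⌋ then z else 0ℂ) ≡ truncate x n (π z)
        truncate-homo n z with fromℕ n ≤? x
        ... | yes _ = refl
        ... | no  _ = 0-homo

      φ : ℕ → ℝ
      φ k = π (f (suc k))

      sum≤-φ : ∀ x → sum≤ x φ ≡ π c * x + π (E x)
      sum≤-φ x = begin-equality
        sum≤ x φ                      ≡⟨ ∑≤-homo x f ⟨
        π (∑≤ x f)                    ≡⟨ cong π (∑≤-f x) ⟩
        π (c *ℂ ofℝ x +ℂ E x)         ≡⟨ +-homo _ _ ⟩
        π (c *ℂ ofℝ x) + π (E x)      ≡⟨ cong (_+ π (E x)) (*ofℝ-homo c x) ⟩
        π c * x + π (E x)             ∎

      open Estimate φ (π c) (λ x → π (E x)) sum≤-φ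

      sum≤-cong : ∀ x {u v : ℕ → ℝ} → (∀ k → u k ≡ v k) → sum≤ x u ≡ sum≤ x v
      sum≤-cong x {u} {v} u≡v = go (proj₁ (archimedean x))
          (λ k → cong (truncate x (suc (toℕ k))) (u≡v (toℕ k)))
        where
        go : ∀ L {s t : Fin L → ℝ} → (∀ k → s k ≡ t k) → sum s ≡ sum t
        go zero    s≡t = refl
        go (suc L) s≡t = cong₂ _+_ (s≡t zero) (go L (λ k → s≡t (suc k)))

      π-remainder : ∀ x →
        π (remainder x) ≡ weightedSum≤ x - (π c * (x * x / 2#) + x * π (E x))
      π-remainder x = trans (-‿homo _ _) (cong₂ _-_
        (trans (∑≤-homo x nf) (sum≤-cong x (λ k → ofℝ*-homo (fromℕ (suc k)) (f (suc k)))))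
        (trans (+-homo _ _) (cong₂ _+_ (*ofℝ-homo _ _) (ofℝ*-homo _ _))))

      -- Stated for the doubled remainder in order to clear the denominator of c x² / 2; the
      -- definition of `Φ` then appears once c x + e is replaced by the sum.
      remainder-Φ : ∀ x → π (remainder x) + π (remainder x) ≡ - Φ x
      remainder-Φ x = begin-equality
        π (remainder x) + π (remainder x)
          ≡⟨ cong (λ u → u + u) (π-remainder x) ⟩
        d + d
          -- The solver sees `2# ⁻¹` as an unknown h, so its product with `2#` is evaluated in the
          -- next step.
          ≡⟨ solve 5 (λ t c x e h →
               (t :- (c :* (x :* x :* h) :+ x :* e)) :+ (t :- (c :* (x :* x :* h) :+ x :* e))
               := con (+ 2) :* (t :- x :* e) :- c :* (x :* x) :* (con (+ 2) :* h))
               refl t (π c) x (π (E x)) (2# ⁻¹) ⟩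
        2# * (t - x * π (E x)) - π c * (x * x) * (2# * 2# ⁻¹)
          ≡⟨ cong (λ u → 2# * (t - x * π (E x)) - π c * (x * x) * u)
               (⁻¹-inverse 2# (1≤x⇒x≢0 1≤1+1)) ⟩
        2# * (t - x * π (E x)) - π c * (x * x) * 1#
          ≡⟨ solve 4 (λ t c x e →
               con (+ 2) :* (t :- x :* e) :- c :* (x :* x) :* con (+ 1)
               := :- (con (+ 2) :* (x :* (c :* x :+ e) :- t) :- c :* (x :* x)))
               refl t (π c) x (π (E x)) ⟩
        - (2# * (x * (π c * x + π (E x)) - t) - π c * (x * x))
          ≡⟨ cong (λ s → - (2# * (x * s - t) - π c * (x * x))) (sum≤-φ x) ⟨
        - Φ x ∎
        where
        t d : ℝ
        t = weightedSum≤ x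
        d = t - (π c * (x * x / 2#) + x * π (E x))

      ∣remainder∣≤∣Φ∣ : ∀ x → ∣ π (remainder x) ∣ ≤ ∣ Φ x ∣
      ∣remainder∣≤∣Φ∣ x = begin
        ∣ π (remainder x) ∣                    ≤⟨ ∣x∣≤∣x+x∣ _ ⟩
        ∣ π (remainder x) + π (remainder x) ∣  ≡⟨ cong ∣_∣ (remainder-Φ x) ⟩
        ∣ - Φ x ∣                              ≡⟨ ∣-x∣≡∣x∣ _ ⟩
        ∣ Φ x ∣                                ∎

      remainder-bound : ∀ {g G A x₀ M} → 0# ≤ A →
        (∀ x → x₀ ≤ x → ‖ E x ‖ ≤ A * g x) →
        (∀ x → 1# ≤ x → IsRiemannIntegral g 1# x (G x)) →
        1# ≤ fromℕ M → x₀ ≤ fromℕ M → ∃ λ C → 0# ≤ C ×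
        (∀ x → fromℕ M ≤ x → ∣ π (remainder x) ∣ ≤ 2# * A * ∣ G x ∣ + C)
      remainder-bound {g} {G} {A} {x₀} {M} 0≤A E-bound G-integral 1≤M x₀≤M =
        let C , 0≤C , bound = Φ-bound g G A x₀ 0≤A
              (λ x x₀≤x → ≤-trans (∣∣≤‖‖ (E x)) (E-bound x x₀≤x)) G-integral {M} 1≤M x₀≤M
        in C , 0≤C , λ x M≤x → ≤-trans (∣remainder∣≤∣Φ∣ x) (bound x M≤x)

  ∈O-*ofℝ : ∀ {E g} → E ∈O g → (λ x → ofℝ x *ℂ E x) ∈O (λ x → x * g x)
  ∈O-*ofℝ {E} {g} (A , x₀ , bound) =
    -- Each of the two coordinates contributes A.
    A + A , x₀ , scaled
    where
    coordinate : ∀ {π} → IsCoordinate π → ∀ x → x₀ ≤ x →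
                 ∣ π (ofℝ x *ℂ E x) ∣ ≤ A * ∣ x * g x ∣
    coordinate {π} π-isCoordinate x x₀≤x = begin
      ∣ π (ofℝ x *ℂ E x) ∣    ≡⟨ cong ∣_∣ (ofℝ*-homo x (E x)) ⟩
      ∣ x * π (E x) ∣         ≡⟨ ∣x*y∣≡∣x∣*∣y∣ _ _ ⟩
      ∣ x ∣ * ∣ π (E x) ∣     ≤⟨ *-monoʳ-≤ (0≤∣x∣ x) (≤-trans (∣∣≤‖‖ (E x)) (bound x x₀≤x)) ⟩
      ∣ x ∣ * (A * ∣ g x ∣)   ≡⟨ solve 3 (λ x A g → x :* (A :* g) := A :* (x :* g))
                                   refl (∣ x ∣) A (∣ g x ∣) ⟩
      A * (∣ x ∣ * ∣ g x ∣)   ≡⟨ cong (A *_) (∣x*y∣≡∣x∣*∣y∣ x (g x)) ⟨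
      A * ∣ x * g x ∣         ∎
      where open IsCoordinate π-isCoordinate
    scaled : ∀ x → x₀ ≤ x → ‖ ofℝ x *ℂ E x ‖ ≤ (A + A) * ∣ x * g x ∣
    scaled x x₀≤x = begin
      ‖ ofℝ x *ℂ E x ‖                                ≤⟨ ‖‖≤∣re∣+∣im∣ _ ⟩
      ∣ re (ofℝ x *ℂ E x) ∣ + ∣ im (ofℝ x *ℂ E x) ∣
        ≤⟨ +-mono-≤ (coordinate re-isCoordinate x x₀≤x)
                    (coordinate im-isCoordinate x x₀≤x) ⟩
      A * ∣ x * g x ∣ + A * ∣ x * g x ∣               ≡⟨ distribʳ _ A A ⟨
      (A + A) * ∣ x * g x ∣                           ∎

  -- Where |G x| ≥ 1 the constant C is at most C |G x|; elsewhere K |G x| is at most K. Giving all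
  -- of D x to one summand in each case yields the constant K + C for both.
  ∈O-split : ∀ {D : ℝ → ℂ} {G : ℝ → ℝ} {K C x₀} → 0# ≤ K → 0# ≤ C →
    (∀ x → x₀ ≤ x → ‖ D x ‖ ≤ K * ∣ G x ∣ + C) →
    ∃ λ D₁ → ∃ λ D₂ → D₁ ∈O G × D₂ ∈O (λ _ → 1#) × (∀ x → D x ≡ D₁ x +ℂ D₂ x)
  ∈O-split {D} {G} {K} {C} {x₀} 0≤K 0≤C bound =
    D₁ , D₂ , (K + C , x₀ , bound₁) , (K + C , x₀ , bound₂) , D≡D₁+D₂
    where
    D₁ D₂ : ℝ → ℂ
    D₁ x = if ⌊ 1# ≤? ∣ G x ∣ ⌋ then D x else 0ℂ
    D₂ x = if ⌊ 1# ≤? ∣ G x ∣ ⌋ then 0ℂ else D x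

    0≤K+C : 0# ≤ K + C
    0≤K+C = +-nonneg 0≤K 0≤C

    ‖0‖≤ : ∀ y → ‖ 0ℂ ‖ ≤ (K + C) * ∣ y ∣
    ‖0‖≤ y = begin
      ‖ 0ℂ ‖          ≤⟨ ‖‖≤∣re∣+∣im∣ 0ℂ ⟩
      ∣ 0# ∣ + ∣ 0# ∣ ≡⟨ cong₂ _+_ (0≤x⇒∣x∣≡x ≤-refl) (0≤x⇒∣x∣≡x ≤-refl) ⟩
      0# + 0#         ≡⟨ +-identityʳ 0# ⟩
      0#              ≤⟨ *-nonneg 0≤K+C (0≤∣x∣ y) ⟩
      (K + C) * ∣ y ∣ ∎

    bound₁ : ∀ x → x₀ ≤ x → ‖ D₁ x ‖ ≤ (K + C) * ∣ G x ∣
    bound₁ x x₀≤x with 1# ≤? ∣ G x ∣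
    ... | no  _     = ‖0‖≤ (G x)
    ... | yes 1≤∣G∣ = begin
      ‖ D x ‖                   ≤⟨ bound x x₀≤x ⟩
      K * ∣ G x ∣ + C           ≡⟨ cong (_+_ (K * ∣ G x ∣)) (*-identityʳ C) ⟨
      K * ∣ G x ∣ + C * 1#      ≤⟨ +-monoʳ-≤ _ (*-monoʳ-≤ 0≤C 1≤∣G∣) ⟩
      K * ∣ G x ∣ + C * ∣ G x ∣ ≡⟨ distribʳ _ K C ⟨
      (K + C) * ∣ G x ∣         ∎

    bound₂ : ∀ x → x₀ ≤ x → ‖ D₂ x ‖ ≤ (K + C) * ∣ 1# ∣
    bound₂ x x₀≤x with 1# ≤? ∣ G x ∣
    ... | yes _     = ‖0‖≤ 1#
    ... | no  1≰∣G∣ = begin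
      ‖ D x ‖          ≤⟨ bound x x₀≤x ⟩
      K * ∣ G x ∣ + C  ≤⟨ +-mono-≤ (*-monoʳ-≤ 0≤K (≰⇒≥ 1≰∣G∣)) ≤-refl ⟩
      K * 1# + C       ≡⟨ solve 2 (λ K C → K :* con (+ 1) :+ C := (K :+ C) :* con (+ 1))
                            refl K C ⟩
      (K + C) * 1#     ≡⟨ cong ((K + C) *_) (0≤x⇒∣x∣≡x 0≤1) ⟨
      (K + C) * ∣ 1# ∣ ∎

    D≡D₁+D₂ : ∀ x → D x ≡ D₁ x +ℂ D₂ x
    D≡D₁+D₂ x with 1# ≤? ∣ G x ∣
    ... | yes _ = sym (cong₂ _+i_ (+-identityʳ _) (+-identityʳ _))
    ... | no  _ = sym (cong₂ _+i_ (+-identityˡ _) (+-identityˡ _))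

-- Assembly of the asymptotic expansion.

mainTheorem2 : ∀ {ℓ} (R : RealField ℓ) → let open Analysis R in
    (f : ArithmeticFunction) (c : ℂ) (g G : ℝ → ℝ) →
    c ≢ 0ℂ →
    EventuallyNonneg g →
    (∀ x → 1# ≤ x → IsRiemannIntegral g 1# x (G x)) →
    (∃ λ (E : ℝ → ℂ) → E ∈O g ×
    (∀ x → ∑≤ x f ≡ c *ℂ ofℝ x +ℂ E x)) →
    ∃ λ (E₁ : ℝ → ℂ) → ∃ λ (E₂ : ℝ → ℂ) → ∃ λ (E₃ : ℝ → ℂ) →
    E₁ ∈O (λ x → x * g x) × E₂ ∈O G × E₃ ∈O (λ _ → 1#) ×
    (∀ x → ∑≤ x (λ n → ofℝ (fromℕ n) *ℂ f n)
    ≡ c *ℂ ofℝ (x * x / (1# + 1#)) +ℂ E₁ x +ℂ E₂ x +ℂ E₃ x)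
mainTheorem2 {ℓ} R f c g G _ (x₁ , g≥0) G-integral (E , (A , x₂ , E-bound) , ∑≤-f) =
  (λ x → ofℝ x *ℂ E x) , D₁ , D₂ , ∈O-*ofℝ (A , x₂ , E-bound) , D₁∈O , D₂∈O , expansion
  where
  open Analysis R
  open OrderedFieldProperties R
  open ComplexRemainder R
  open IntegerCoefficients commutativeRing using (solve; con; _:=_; _:+_; _:*_; _:-_)
  open PartialOrderReasoning ≤-poset

  D : ℝ → ℂ
  D = remainder f c E

  x₀ : ℝ
  -- The sum of absolute values dominates both thresholds.
  x₀ = ∣ x₁ ∣ + ∣ x₂ ∣

  M : ℕ
  -- The successor guarantees 1 ≤ M, so that the integrals from 1 are available at M and beyond.
  M = suc (proj₁ (archimedean x₀))

  1≤M : 1# ≤ fromℕ M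
  1≤M = x≤x+y 1# (fromℕ-nonneg (proj₁ (archimedean x₀)))

  x₀≤M : x₀ ≤ fromℕ M
  x₀≤M = ≤-trans (proj₂ (archimedean x₀)) (fromℕ-mono-≤ (ℕ.n≤1+n (proj₁ (archimedean x₀))))

  -- The constant A in the Landau bound may be negative, hence |A|; beyond x₁ the absolute value of
  -- g is g itself.
  E-bound′ : ∀ x → x₀ ≤ x → ‖ E x ‖ ≤ ∣ A ∣ * g x
  E-bound′ x x₀≤x = begin
    ‖ E x ‖          ≤⟨ E-bound x x₂≤x ⟩
    A * ∣ g x ∣      ≤⟨ *-monoˡ-≤ (0≤∣x∣ (g x)) (x≤∣x∣ A) ⟩
    ∣ A ∣ * ∣ g x ∣  ≡⟨ cong (∣ A ∣ *_) (0≤x⇒∣x∣≡x (g≥0 x x₁≤x)) ⟩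
    ∣ A ∣ * g x      ∎
    where
    x₁≤x : x₁ ≤ x
    x₁≤x = ≤-trans (x≤∣x∣ x₁) (≤-trans (x≤x+y _ (0≤∣x∣ x₂)) x₀≤x)
    x₂≤x : x₂ ≤ x
    x₂≤x = ≤-trans (x≤∣x∣ x₂)
      (≤-trans (gap⇒≤ ∣ x₁ ∣ (0≤∣x∣ x₁) (+-comm _ _)) x₀≤x)

  CoordinateBound : (ℂ → ℝ) → Set ℓ
  CoordinateBound π = ∃ λ C → 0# ≤ C ×
    (∀ x → fromℕ M ≤ x → ∣ π (D x) ∣ ≤ (1# + 1#) * ∣ A ∣ * ∣ G x ∣ + C)

  coordinate-bound : ∀ {π} → IsCoordinate π → CoordinateBound π
  coordinate-bound π-isCoordinate =
    Coordinate.remainder-bound f c E π-isCoordinate ∑≤-f {g} {G} {∣ A ∣} {x₀} {M}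
      (0≤∣x∣ A) E-bound′ G-integral 1≤M x₀≤M

  K : ℝ
  K = (1# + 1#) * ∣ A ∣

  0≤K : 0# ≤ K
  0≤K = *-nonneg (+-nonneg 0≤1 0≤1) (0≤∣x∣ A)

  split : ∃ λ D₁ → ∃ λ D₂ → D₁ ∈O G × D₂ ∈O (λ _ → 1#) × (∀ x → D x ≡ D₁ x +ℂ D₂ x)
  split =
    let C , 0≤C , re-bound = coordinate-bound re-isCoordinate
        C′ , 0≤C′ , im-bound = coordinate-bound im-isCoordinate
    in ∈O-split (+-nonneg 0≤K 0≤K) (+-nonneg 0≤C 0≤C′) λ x M≤x → begin
      ‖ D x ‖                                  ≤⟨ ‖‖≤∣re∣+∣im∣ (D x) ⟩
      ∣ re (D x) ∣ + ∣ im (D x) ∣              ≤⟨ +-mono-≤ (re-bound x M≤x) (im-bound x M≤x) ⟩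
      K * ∣ G x ∣ + C + (K * ∣ G x ∣ + C′)     ≡⟨ solve 4 (λ K u C C′ →
                                                    K :* u :+ C :+ (K :* u :+ C′)
                                                    := (K :+ K) :* u :+ (C :+ C′))
                                                    refl K (∣ G x ∣) C C′ ⟩
      (K + K) * ∣ G x ∣ + (C + C′)             ∎

  D₁ D₂ : ℝ → ℂ
  D₁ = proj₁ split
  D₂ = proj₁ (proj₂ split)

  D₁∈O : D₁ ∈O G
  D₁∈O = proj₁ (proj₂ (proj₂ split))

  D₂∈O : D₂ ∈O (λ _ → 1#)
  D₂∈O = proj₁ (proj₂ (proj₂ (proj₂ split)))

  +ℂ-assoc : ∀ z w v → z +ℂ w +ℂ v ≡ z +ℂ (w +ℂ v)
  +ℂ-assoc z w v = cong₂ _+i_ (+-assoc _ _ _) (+-assoc _ _ _)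

  z≡w+[z-w] : ∀ z w → z ≡ w +ℂ (z -ℂ w)
  z≡w+[z-w] z w = cong₂ _+i_ (real (re z) (re w)) (real (im z) (im w))
    where
    real : ∀ x y → x ≡ y + (x - y)
    real = solve 2 (λ x y → x := y :+ (x :- y)) refl

  expansion : ∀ x → ∑≤ x (λ n → ofℝ (fromℕ n) *ℂ f n)
                ≡ c *ℂ ofℝ (x * x / (1# + 1#)) +ℂ ofℝ x *ℂ E x +ℂ D₁ x +ℂ D₂ x
  -- The sum is `main` plus its difference from `main`, which is D x and splits into D₁ x and D₂ x.
  expansion x = trans (z≡w+[z-w] _ main)
    (trans (cong (main +ℂ_) (proj₂ (proj₂ (proj₂ (proj₂ split))) x))
      (sym (+ℂ-assoc main (D₁ x) (D₂ x))))
    where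
    main : ℂ
    main = c *ℂ ofℝ (x * x / (1# + 1#)) +ℂ ofℝ x *ℂ E x
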